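{- Every omnitonal graph is bipartite.
   Context: Graphs are finite and simple; $e(G)=|E(G)|$. A $2$-coloring $E(K_n)=E(R)\cup E(B)$ is a partition of the edges of $K_n$ into red edges (forming $R$) and blue edges (forming $B$). An $(r,b)$-colored copy of $G$ (with $r+b=e(G)$) is a (not necessarily induced) subgraph of $K_n$ isomorphic to $G$ with exactly $r$ red and $b$ blue edges. ${\rm ot}(n,G)$ is the minimum non-negative integer $s$ such that every $2$-coloring $E(K_n)=E(R)\cup E(B)$ with $\min\{e(R),e(B)\}>s$ contains an $(r,b)$-colored copy of $G$ for every pair of integers $r,b\ge0$ with $r+b=e(G)$. The graph $G$ is omnitonal if for every sufficiently large $n$ such an integer exists non-vacuously, that is, ${\rm ot}(n,G)<\lfloor\frac12\binom n2\rfloor$ (so that there are colorings with $\min\{e(R),e(B)\}>{\rm ot}(n,G)$). -}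

module Defs where

open import Level using (0ℓ; suc)
open import Data.Bool.Base using (Bool)
open import Data.Fin.Base using (Fin)
open import Data.Fin.Properties using (_<?_)
open import Data.Fin.Subset using (Subset; _∈_)
open import Data.List.Base using (List; allFin; cartesianProduct; filter; length)
open import Data.Nat.Base using (ℕ; _+_; _≤_; _<_; _⊓_; ⌊_/2⌋)
open import Data.Nat.Combinatorics using (_C_)
open import Data.Product.Base using (_×_; _,_; ∃-syntax; Σ-syntax; map)
open import Data.Sum.Base using (_⊎_)
open import Function.Bundles using (_⇔_)
open import Function.Definitions using (Injective)
open import Relation.Binary.Core using (Rel)
open import Relation.Binary.Definitions using (Decidable; Irreflexive; Symmetric)
open import Relation.Binary.PropositionalEquality using (_≡_; _≢_)
open import Relation.Nullary.Decidable using (_×-dec_)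
open import Relation.Nullary.Negation using (¬_)

-- Finite simple graphs, with vertex set normalised to Fin n.
record Graph (n : ℕ) : Set (suc 0ℓ) where
  field
    Adj    : Rel (Fin n) 0ℓ
    adj?   : Decidable Adj
    sym    : Symmetric Adj
    irrefl : Irreflexive _≡_ Adj

open Graph public using (Adj)

-- Each edge {i , j} is listed once, as the pair with i < j.
edges : ∀ {n} → Graph n → List (Fin n × Fin n)
edges {n} G =
  filter (λ (i , j) → (i <? j) ×-dec Graph.adj? G i j)
         (cartesianProduct (allFin n) (allFin n))

e : ∀ {n} → Graph n → ℕ
e G = length (edges G)

_∩ᴳ_ : ∀ {n} → Graph n → Graph n → Graph n
G ∩ᴳ H = record
  { Adj    = λ u v → Adj G u v × Adj H u v
  ; adj?   = λ u v → Graph.adj? G u v ×-dec Graph.adj? H u v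
  ; sym    = map (Graph.sym G) (Graph.sym H)
  ; irrefl = λ { u≡v (p , _) → Graph.irrefl G u≡v p }
  }

Bipartite : ∀ {k} → Graph k → Set
Bipartite {k} G =
  Σ[ side ∈ (Fin k → Bool) ] (∀ {u v} → Adj G u v → side u ≢ side v)

record TwoColoring (n : ℕ) : Set (suc 0ℓ) where
  field
    R B      : Graph n
    covers   : ∀ {u v} → u ≢ v → Adj R u v ⊎ Adj B u v
    disjoint : ∀ {u v} → Adj R u v → ¬ Adj B u v

-- A subgraph of Kₙ: any set of vertices together with any set of edges
-- between them.  The ambient Graph n holds the edge set.
record SubgraphOfK (n : ℕ) : Set (suc 0ℓ) where
  field
    vertices : Subset n
    edgeSet  : Graph n
    endpoint : ∀ {u v} → Adj edgeSet u v → u ∈ vertices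

open SubgraphOfK public using (vertices; edgeSet)

record _≅_ {k n} (G : Graph k) (H : SubgraphOfK n) : Set where
  field
    to        : Fin k → Fin n
    injective : Injective _≡_ _≡_ to
    image     : ∀ {v} → v ∈ vertices H ⇔ (∃[ u ] to u ≡ v)
    preserves : ∀ {u v} → Adj G u v ⇔ Adj (edgeSet H) (to u) (to v)

HasColoredCopy : ∀ {n k} → TwoColoring n → Graph k → ℕ → ℕ → Set (suc 0ℓ)
HasColoredCopy {n} c G r b =
  ∃[ H ] G ≅ H × e (edgeSet H ∩ᴳ R) ≡ r × e (edgeSet H ∩ᴳ B) ≡ b
  where open TwoColoring c

OtBound : ∀ {k} → ℕ → Graph k → ℕ → Set (suc 0ℓ)
OtBound n G s =
  (c : TwoColoring n) → let open TwoColoring c in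
  s < e R ⊓ e B →
  ∀ r b → r + b ≡ e G → HasColoredCopy c G r b

-- ot(n,G) as a relation: IsOt n G s says that ot(n,G) = s.
IsOt : ∀ {k} → ℕ → Graph k → ℕ → Set (suc 0ℓ)
IsOt n G s = OtBound n G s × (∀ t → OtBound n G t → s ≤ t)

Omnitonal : ∀ {k} → Graph k → Set (suc 0ℓ)
Omnitonal G =
  ∃[ N ] ∀ n → N ≤ n → ∃[ s ] IsOt n G s × s < ⌊ n C 2 /2⌋

{-# OPTIONS --safe #-}
module Submission where

-- If a and b are consecutive triangular numbers, the complete bipartite graph
-- with sides of size a and b takes exactly half of the edges of the complete
-- graph on n = a + b = (j + 1)² vertices.  Coloring it red and the rest blue
-- gives, for infinitely many n, a balanced coloring in which a copy of G
-- without blue edges is bipartite.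

open import Defs
open import Data.Bool.Base using (Bool; true; false)
import Data.Bool.Properties as Bool
open import Data.Fin.Base as Fin using (Fin; zero; suc)
import Data.Fin.Properties as Fin
open import Data.List.Base
  using (List; []; _∷_; _++_; allFin; cartesianProduct; filter; length; map; tabulate)
open import Data.List.Membership.Propositional using (_∉_)
open import Data.List.Membership.Propositional.Properties
  using (∈-allFin; ∈-cartesianProduct⁺; ∈-filter⁺)
open import Data.List.Properties
  using (filter-++; filter-all; filter-none; length-++; length-tabulate; map-tabulate)
import Data.List.Relation.Unary.All as All
open import Data.Nat.Base using (ℕ; zero; suc; _+_; _*_; _⊓_; ⌊_/2⌋; z<s; s<s; s<s⁻¹)
open import Data.Nat.Combinatorics using (_C_; nC1≡n; nCk+nC[k+1]≡[n+1]C[k+1])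
open import Data.Nat.Properties
open import Data.Nat.Tactic.RingSolver using (solve-∀)
open import Data.Product.Base using (_×_; _,_; proj₂)
open import Data.Sum.Base using (_⊎_; inj₁; inj₂)
open import Function.Base using (_∘_; id)
open import Function.Bundles using (_⇔_; mk⇔; Equivalence)
open import Level using (Level)
open import Relation.Binary.Definitions using (tri<; tri≈; tri>)
open import Relation.Binary.PropositionalEquality
open import Relation.Nullary.Decidable using (yes; no; ¬?; _×-dec_)
open import Relation.Nullary.Negation using (¬_; contradiction)
open import Relation.Unary using (Pred; Decidable)

-- Counting in filtered lists

private variable
  ℓ ℓ′ p q : Level
  X : Set ℓ
  Y : Set ℓ′

length-filter-++ : {P : Pred X p} (P? : Decidable P) (xs ys : List X) →
  length (filter P? (xs ++ ys)) ≡ length (filter P? xs) + length (filter P? ys)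
length-filter-++ P? xs ys =
  trans (cong length (filter-++ P? xs ys)) (length-++ (filter P? xs))

length-filter-map : {P : Pred Y p} {Q : Pred X q} (P? : Decidable P) (Q? : Decidable Q)
  (f : X → Y) → (∀ x → P (f x) ⇔ Q x) →
  ∀ xs → length (filter P? (map f xs)) ≡ length (filter Q? xs)
length-filter-map P? Q? f P⇔Q [] = refl
length-filter-map P? Q? f P⇔Q (x ∷ xs) with P? (f x) | Q? x
... | yes _ | yes _ = cong suc (length-filter-map P? Q? f P⇔Q xs)
... | no  _ | no  _ = length-filter-map P? Q? f P⇔Q xs
... | yes p | no ¬q = contradiction (Equivalence.to (P⇔Q x) p) ¬q
... | no ¬p | yes q = contradiction (Equivalence.from (P⇔Q x) q) ¬p

length-filter-complement : {P : Pred X p} {Q : Pred X q} (P? : Decidable P) (Q? : Decidable Q) →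
  (∀ x → Q x ⇔ (¬ P x)) →
  ∀ xs → length (filter P? xs) + length (filter Q? xs) ≡ length xs
length-filter-complement P? Q? Q⇔¬P [] = refl
length-filter-complement P? Q? Q⇔¬P (x ∷ xs) with P? x | Q? x
... | yes _ | no  _ = cong suc (length-filter-complement P? Q? Q⇔¬P xs)
... | no  _ | yes _ =
  trans (+-suc _ _) (cong suc (length-filter-complement P? Q? Q⇔¬P xs))
... | yes p | yes q = contradiction p (Equivalence.to (Q⇔¬P x) q)
... | no ¬p | no ¬q = contradiction (Equivalence.from (Q⇔¬P x) ¬p) ¬q

-- Counting edges by deleting the vertex `zero`

tailᴳ : ∀ {n} → Graph (suc n) → Graph n
tailᴳ G = record
  { Adj    = λ u v → Adj G (suc u) (suc v)
  ; adj?   = λ u v → Graph.adj? G (suc u) (suc v)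
  ; sym    = Graph.sym G
  ; irrefl = λ u≡v → Graph.irrefl G (cong suc u≡v)
  }

degree₀ : ∀ {n} → Graph (suc n) → ℕ
degree₀ {n} G = length (filter (Graph.adj? G zero ∘ suc) (allFin n))

module _ {n} (G : Graph n) where

  Edge : Pred (Fin n × Fin n) _
  Edge (i , j) = i Fin.< j × Adj G i j

  edge? : Decidable Edge
  edge? (i , j) = (i Fin.<? j) ×-dec Graph.adj? G i j

-- Edges are listed as increasing pairs, so no pair with second entry `zero` counts. The two factors
-- are kept separate because the induction shrinks `xs` while `ys` stays fixed.
length-edges-tail : ∀ {n} (G : Graph (suc n)) xs ys →
  length (filter (edge? G) (cartesianProduct (map suc xs) (zero ∷ map suc ys))) ≡
  length (filter (edge? (tailᴳ G)) (cartesianProduct xs ys))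
length-edges-tail G [] ys = refl
length-edges-tail G (x ∷ xs) ys = begin
  -- The pair `(suc x , zero)` has already been dropped by computation of the order test.
  length (filter (edge? G) (map (suc x ,_) (map suc ys) ++ rest))
    ≡⟨ length-filter-++ (edge? G) (map (suc x ,_) (map suc ys)) rest ⟩
  length (filter (edge? G) (map (suc x ,_) (map suc ys))) + length (filter (edge? G) rest)
    ≡⟨ cong₂ _+_ row (length-edges-tail G xs ys) ⟩
  length (filter (edge? (tailᴳ G)) (map (x ,_) ys)) +
  length (filter (edge? (tailᴳ G)) (cartesianProduct xs ys))
    ≡⟨ length-filter-++ (edge? (tailᴳ G)) (map (x ,_) ys) (cartesianProduct xs ys) ⟨
  length (filter (edge? (tailᴳ G)) (map (x ,_) ys ++ cartesianProduct xs ys)) ∎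
  where
  open ≡-Reasoning
  rest = cartesianProduct (map suc xs) (zero ∷ map suc ys)
  row : length (filter (edge? G) (map (suc x ,_) (map suc ys))) ≡
        length (filter (edge? (tailᴳ G)) (map (x ,_) ys))
  row = trans
    (length-filter-map (edge? G) (λ y → edge? G (suc x , y)) (suc x ,_)
      (λ _ → mk⇔ id id) (map suc ys))
    (trans
      (length-filter-map _ (λ y → edge? (tailᴳ G) (x , y)) suc
        (λ _ → mk⇔ (λ (lt , adj) → s<s⁻¹ lt , adj) (λ (lt , adj) → s<s lt , adj)) ys)
      (sym (length-filter-map (edge? (tailᴳ G)) _ (x ,_) (λ _ → mk⇔ id id) ys)))

-- As `zero` is the least vertex, the edges at it are all listed in the row of pairs that begin with
-- `zero`. The remaining rows list the edges that avoid it.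
e-suc : ∀ {n} (G : Graph (suc n)) → e G ≡ degree₀ G + e (tailᴳ G)
e-suc {n} G = begin
  length (filter (edge? G) (map (zero ,_) (tabulate suc) ++
    cartesianProduct (tabulate suc) (zero ∷ tabulate suc)))
    ≡⟨ cong (λ zs → length (filter (edge? G)
         (map (zero ,_) zs ++ cartesianProduct zs (zero ∷ zs)))) (map-tabulate id suc) ⟨
  length (filter (edge? G) (row ++ rest))
    ≡⟨ length-filter-++ (edge? G) row rest ⟩
  length (filter (edge? G) row) + length (filter (edge? G) rest)
    ≡⟨ cong₂ _+_ degree (length-edges-tail G (allFin n) (allFin n)) ⟩
  degree₀ G + e (tailᴳ G) ∎
  where
  open ≡-Reasoning
  row  = map (zero ,_) (map suc (allFin n))
  rest = cartesianProduct (map suc (allFin n)) (zero ∷ map suc (allFin n))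
  degree : length (filter (edge? G) row) ≡ degree₀ G
  degree = trans
    (length-filter-map (edge? G) (λ y → edge? G (zero , y)) (zero ,_)
      (λ _ → mk⇔ id id) (map suc (allFin n)))
    (length-filter-map _ _ suc (λ _ → mk⇔ proj₂ (z<s ,_)) (allFin n))

e≡0⇒¬Edge : ∀ {n} (G : Graph n) → e G ≡ 0 → ∀ {x} → ¬ Edge G x
e≡0⇒¬Edge G e≡0 {i , j} ij = length≡0⇒∉ e≡0
  (∈-filter⁺ (edge? G) (∈-cartesianProduct⁺ (∈-allFin i) (∈-allFin j)) ij)
  where
  length≡0⇒∉ : {x : X} {xs : List X} → length xs ≡ 0 → x ∉ xs
  length≡0⇒∉ {xs = []} _ ()

e≡0⇒¬Adj : ∀ {n} (G : Graph n) → e G ≡ 0 → ∀ {u v} → ¬ Adj G u v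
e≡0⇒¬Adj G e≡0 {u} {v} adj with Fin.<-cmp u v
... | tri< u<v _ _ = e≡0⇒¬Edge G e≡0 (u<v , adj)
... | tri≈ _ u≡v _ = Graph.irrefl G u≡v adj
... | tri> _ _ v<u = e≡0⇒¬Edge G e≡0 (v<u , Graph.sym G adj)

-- The total number of edges of a 2-coloring

tailᶜ : ∀ {n} → TwoColoring (suc n) → TwoColoring n
tailᶜ c = record
  { R        = tailᴳ R
  ; B        = tailᴳ B
  ; covers   = λ u≢v → covers (u≢v ∘ Fin.suc-injective)
  ; disjoint = disjoint
  }
  where open TwoColoring c

choose₂-suc : ∀ n → suc n C 2 ≡ n + n C 2
choose₂-suc n = trans (sym (nCk+nC[k+1]≡[n+1]C[k+1] n 1)) (cong (_+ n C 2) (nC1≡n n))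

-- Induction on `n`: each of the other vertices is joined to `zero` in exactly one color, so the two
-- degrees of `zero` add up to the increment in Pascal's rule.
e-R+e-B : ∀ n (c : TwoColoring n) → let open TwoColoring c in e R + e B ≡ n C 2
e-R+e-B zero c = refl
e-R+e-B (suc n) c = begin
  e R + e B
    ≡⟨ cong₂ _+_ (e-suc R) (e-suc B) ⟩
  (degree₀ R + e (tailᴳ R)) + (degree₀ B + e (tailᴳ B))
    ≡⟨ medial (degree₀ R) _ (degree₀ B) _ ⟩
  (degree₀ R + degree₀ B) + (e (tailᴳ R) + e (tailᴳ B))
    ≡⟨ cong₂ _+_ degrees (e-R+e-B n (tailᶜ c)) ⟩
  n + n C 2
    ≡⟨ choose₂-suc n ⟨
  suc n C 2 ∎
  where
  open ≡-Reasoning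
  open TwoColoring c
  medial : ∀ a b c d → (a + b) + (c + d) ≡ (a + c) + (b + d)
  medial = solve-∀
  blue : ∀ {v} → ¬ Adj R zero (suc v) → Adj B zero (suc v)
  blue {v} ¬red with covers {zero} {suc v} (λ ())
  ... | inj₁ red  = contradiction red ¬red
  ... | inj₂ adj  = adj
  degrees : degree₀ R + degree₀ B ≡ n
  degrees = trans
    (length-filter-complement (Graph.adj? R zero ∘ suc) (Graph.adj? B zero ∘ suc)
      (λ _ → mk⇔ (λ b r → disjoint r b) blue) (allFin n))
    (length-tabulate id)

-- Cut colorings: red complete bipartite graph, blue cliques on the two sides

cutColoring : ∀ {n} → (Fin n → Bool) → TwoColoring n
cutColoring side = record
  { R = record
    { Adj    = λ u v → side u ≢ side v
    ; adj?   = λ u v → ¬? (side u Bool.≟ side v)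
    ; sym    = λ ≢ → ≢ ∘ sym
    ; irrefl = λ u≡v ≢ → ≢ (cong side u≡v)
    }
  ; B = record
    { Adj    = λ u v → u ≢ v × side u ≡ side v
    ; adj?   = λ u v → ¬? (u Fin.≟ v) ×-dec (side u Bool.≟ side v)
    ; sym    = λ (u≢v , ≡) → u≢v ∘ sym , sym ≡
    ; irrefl = λ u≡v (u≢v , _) → u≢v u≡v
    }
  ; covers   = covers
  ; disjoint = λ ≢ (_ , ≡) → ≢ ≡
  }
  where
  covers : ∀ {u v} → u ≢ v → (side u ≢ side v) ⊎ (u ≢ v × side u ≡ side v)
  covers {u} {v} u≢v with side u Bool.≟ side v
  ... | yes ≡ = inj₂ (u≢v , ≡)
  ... | no  ≢ = inj₁ ≢

inFirst : ∀ a b → Fin (a + b) → Bool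
inFirst zero    b _       = false
inFirst (suc a) b zero    = true
inFirst (suc a) b (suc i) = inFirst a b i

-- Phrased with `true`, the side of `zero` in the cut with parameters `suc a` and `b`, so that it
-- agrees by computation with red adjacency to `zero` there.
inSecond? : ∀ a b → Decidable (λ i → true ≢ inFirst a b i)
inSecond? a b i = ¬? (true Bool.≟ inFirst a b i)

length-inSecond : ∀ a b → length (filter (inSecond? a b) (allFin (a + b))) ≡ b
length-inSecond zero b = trans
  (cong length (filter-all (inSecond? zero b) (All.universal (λ _ ()) (allFin b))))
  (length-tabulate id)
length-inSecond (suc a) b = begin
  length (filter (inSecond? (suc a) b) (tabulate suc))
    ≡⟨ cong (length ∘ filter (inSecond? (suc a) b)) (map-tabulate id suc) ⟨
  length (filter (inSecond? (suc a) b) (map suc (allFin (a + b))))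
    ≡⟨ length-filter-map (inSecond? (suc a) b) (inSecond? a b) suc
         (λ _ → mk⇔ id id) (allFin (a + b)) ⟩
  length (filter (inSecond? a b) (allFin (a + b)))
    ≡⟨ length-inSecond a b ⟩
  b ∎
  where open ≡-Reasoning

-- Induction on `a`: a vertex of the first side has exactly the `b` vertices of the second side as
-- red neighbors, and deleting it leaves the cut with sides `a` and `b`.
e-cut : ∀ a b → e (TwoColoring.R (cutColoring (inFirst a b))) ≡ a * b
e-cut zero b = cong length
  (filter-none (edge? R) (All.universal (λ _ (_ , ≢) → ≢ refl)
    (cartesianProduct (allFin b) (allFin b))))
  where open TwoColoring (cutColoring (inFirst zero b))
e-cut (suc a) b = trans
  (e-suc (TwoColoring.R (cutColoring (inFirst (suc a) b))))
  (cong₂ _+_ (length-inSecond a b) (e-cut a b))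

-- Triangular numbers and the balanced coloring

double-choose₂ : ∀ m → 2 * (suc m C 2) ≡ suc m * m
double-choose₂ zero = refl
double-choose₂ (suc m) = begin
  2 * (suc (suc m) C 2)       ≡⟨ cong (2 *_) (choose₂-suc (suc m)) ⟩
  2 * (suc m + suc m C 2)     ≡⟨ *-distribˡ-+ 2 (suc m) (suc m C 2) ⟩
  2 * suc m + 2 * (suc m C 2) ≡⟨ cong (2 * suc m +_) (double-choose₂ m) ⟩
  2 * suc m + suc m * m       ≡⟨ ring m ⟩
  suc (suc m) * suc m         ∎
  where
  open ≡-Reasoning
  ring : ∀ m → 2 * (1 + m) + (1 + m) * m ≡ (2 + m) * (1 + m)
  ring = solve-∀

module _ (j : ℕ) where
  private
    a = suc j C 2
    b = suc (suc j) C 2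

  -- The sum is the square of `suc j`, written as a successor so that `double-choose₂` applies to
  -- it.
  consecutive-triangular-sum : a + b ≡ suc (j * (2 + j))
  consecutive-triangular-sum = *-cancelˡ-≡ _ _ 2 (begin
    2 * (a + b)                       ≡⟨ *-distribˡ-+ 2 a b ⟩
    2 * a + 2 * b                     ≡⟨ cong₂ _+_ (double-choose₂ j) (double-choose₂ (suc j)) ⟩
    suc j * j + suc (suc j) * suc j   ≡⟨ ring j ⟩
    2 * suc (j * (2 + j))             ∎)
    where
    open ≡-Reasoning
    ring : ∀ j → (1 + j) * j + (2 + j) * (1 + j) ≡ 2 * (1 + j * (2 + j))
    ring = solve-∀

  -- With n = (j + 1)², the number n - 1 factors as j (j + 2). Hence n (n - 1) regroups as the
  -- product of j (j + 1) and (j + 1) (j + 2), which are `2 * a` and `2 * b`.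
  choose₂-consecutive-triangular-sum : (a + b) C 2 ≡ a * b + a * b
  choose₂-consecutive-triangular-sum = *-cancelˡ-≡ _ _ 2 (begin
    2 * ((a + b) C 2)                  ≡⟨ cong (λ n → 2 * (n C 2)) consecutive-triangular-sum ⟩
    2 * (suc (j * (2 + j)) C 2)        ≡⟨ double-choose₂ (j * (2 + j)) ⟩
    suc (j * (2 + j)) * (j * (2 + j))  ≡⟨ ring₁ j ⟩
    (suc j * j) * (suc (suc j) * suc j)
      ≡⟨ cong₂ _*_ (double-choose₂ j) (double-choose₂ (suc j)) ⟨
    (2 * a) * (2 * b)                  ≡⟨ ring₂ a b ⟩
    2 * (a * b + a * b)                ∎)
    where
    open ≡-Reasoning
    ring₁ : ∀ j → (1 + j * (2 + j)) * (j * (2 + j)) ≡ ((1 + j) * j) * ((2 + j) * (1 + j))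
    ring₁ = solve-∀
    ring₂ : ∀ a b → (2 * a) * (2 * b) ≡ 2 * (a * b + a * b)
    ring₂ = solve-∀

  balancedColoring : TwoColoring (a + b)
  balancedColoring = cutColoring (inFirst a b)

  balancedColoring-balanced : let open TwoColoring balancedColoring in
    e R ⊓ e B ≡ ⌊ (a + b) C 2 /2⌋
  balancedColoring-balanced = begin
    e R ⊓ e B             ≡⟨ cong₂ _⊓_ (e-cut a b) e-B ⟩
    (a * b) ⊓ (a * b)      ≡⟨ ⊓-idem (a * b) ⟩
    a * b                 ≡⟨ n≡⌊n+n/2⌋ (a * b) ⟩
    ⌊ a * b + a * b /2⌋   ≡⟨ cong ⌊_/2⌋ choose₂-consecutive-triangular-sum ⟨
    ⌊ (a + b) C 2 /2⌋     ∎
    where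
    open ≡-Reasoning
    open TwoColoring balancedColoring
    e-B : e B ≡ a * b
    -- The blue cliques are not counted directly: blue is what red leaves of the total.
    e-B = +-cancelˡ-≡ (a * b) _ _ (begin
      a * b + e B     ≡⟨ cong (_+ e B) (e-cut a b) ⟨
      e R + e B       ≡⟨ e-R+e-B (a + b) balancedColoring ⟩
      (a + b) C 2     ≡⟨ choose₂-consecutive-triangular-sum ⟩
      a * b + a * b   ∎)

-- Copies without blue edges

-- The cut pulls back along the embedding of `G`: an edge with both ends on one side would become a
-- blue edge of the copy.
redCopy⇒Bipartite : ∀ {n k r} (side : Fin n → Bool) (G : Graph k) →
  HasColoredCopy (cutColoring side) G r 0 → Bipartite G
redCopy⇒Bipartite side G (H , G≅H , _ , e≡0) = side ∘ to , bichromatic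
  where
  open _≅_ G≅H
  open TwoColoring (cutColoring side)
  bichromatic : ∀ {u v} → Adj G u v → side (to u) ≢ side (to v)
  bichromatic adj ≡ = e≡0⇒¬Adj (edgeSet H ∩ᴳ B) e≡0
    ( Equivalence.to preserves adj
    -- Equal sides alone do not make a blue edge; the two images must also be distinct.
    , (λ to-≡ → Graph.irrefl G (injective to-≡) adj)
    , ≡ )

theorem2p8 : (k : ℕ) (G : Graph k) → Omnitonal G → Bipartite G
theorem2p8 k G (N , ot<half) =
  -- Taking `N` itself as the index `j` makes the number of vertices (N + 1)², which is at least
  -- `N`.
  let N≤n = ≤-trans (≤-trans (m≤m*n N (2 + N)) (n≤1+n _))
              (≤-reflexive (sym (consecutive-triangular-sum N)))
      s , (bound , _) , s<half = ot<half _ N≤n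
      s<min = <-≤-trans s<half (≤-reflexive (sym (balancedColoring-balanced N)))
  -- The pair r = `e G`, b = 0 asks for an entirely red copy.
  in redCopy⇒Bipartite _ G (bound (balancedColoring N) s<min (e G) 0 (+-identityʳ (e G)))
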